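{- There exist five distinct points $p_1,\dots,p_5$ in the plane (not necessarily in general position) such that there is no family $K_1,\dots,K_5$ of pairwise intersecting compact convex sets in the plane with $o(K_iK_jK_k)=o(p_ip_jp_k)$ for all distinct $i,j,k\in\{1,\dots,5\}$.
   Context: For points $p,q,r$ in the plane, $o(pqr)\in\{+1,0,-1\}$ is $+1$ if $p,q,r$ form a counterclockwise triangle, $-1$ if clockwise, and $0$ if they are collinear. For three pairwise intersecting compact convex sets $A,B,C$ in the plane: if $A\cap B\cap C\neq\emptyset$ then $o(ABC)=0$; otherwise $o(ABC)=o(xyz)$ for any $x\in B\cap C$, $y\in A\cap C$, $z\in A\cap B$ (this orientation is known not to depend on the choice of $x,y,z$, and is nonzero). -}

module Defs where

open import Data.Fin.Base using (Fin)
open import Data.Integer.Base using (ℤ; 0ℤ; 1ℤ; -1ℤ)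
open import Data.List.Base using (List)
open import Data.List.Relation.Unary.Any using (Any)
open import Data.Nat.Base as ℕ using (ℕ)
import Data.Nat.Properties as ℕ
open import Data.Product.Base using (Σ-syntax; ∃-syntax; _×_; _,_)
open import Data.Rational.Base as ℚ using (ℚ; 0ℚ; 1ℚ; ½)
import Data.Rational.Properties as ℚ
open import Data.Rational.Solver using (module +-*-Solver)
open import Level using (0ℓ)
open import Relation.Binary.Core using (Rel)
open import Relation.Binary.Definitions using (_Respects_)
open import Relation.Binary.PropositionalEquality
  using (_≡_; _≢_; refl; sym; trans; cong; subst; subst₂)
open import Relation.Nullary.Negation.Core using (¬_)
open import Relation.Unary using (Pred; _∈_; _⊆_; _∩_; _≬_; ⋃; Empty; Satisfiable)

------------------------------------------------------------------------
-- Real numbers: Cauchy sequences of rationals, as a setoid.  The field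
-- operations are pointwise; _≈_ says that the difference tends to 0,
-- and x < y that y - x is eventually bounded below by a positive
-- rational.

IsCauchy : (ℕ → ℚ) → Set
IsCauchy s = ∀ ε → 0ℚ ℚ.< ε →
  ∃[ N ] (∀ m n → N ℕ.≤ m → N ℕ.≤ n → ℚ.∣ s m ℚ.- s n ∣ ℚ.< ε)

record ℝ : Set where
  constructor mkℝ
  field
    seq    : ℕ → ℚ
    cauchy : IsCauchy seq

open ℝ public

module CauchyLemmas where

  half-pos : ∀ {ε} → 0ℚ ℚ.< ε → 0ℚ ℚ.< ½ ℚ.* ε
  half-pos {ε} 0<ε = subst (ℚ._< ½ ℚ.* ε) (ℚ.*-zeroʳ ½) (ℚ.*-monoʳ-<-pos ½ 0<ε)

  half+half : ∀ ε → ½ ℚ.* ε ℚ.+ ½ ℚ.* ε ≡ ε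
  half+half ε = trans (sym (ℚ.*-distribʳ-+ ε ½ ½)) (ℚ.*-identityˡ ε)

  interchange : ∀ a b c d →
    (a ℚ.+ b) ℚ.- (c ℚ.+ d) ≡ (a ℚ.- c) ℚ.+ (b ℚ.- d)
  interchange = solve 4 (λ a b c d →
    (a :+ b) :- (c :+ d) := (a :- c) :+ (b :- d)) refl
    where open +-*-Solver

  neg-sub : ∀ a b → (ℚ.- a) ℚ.- (ℚ.- b) ≡ ℚ.- (a ℚ.- b)
  neg-sub = solve 2 (λ a b → (:- a) :- (:- b) := :- (a :- b)) refl
    where open +-*-Solver

  mul-sub : ∀ a b c d →
    a ℚ.* b ℚ.- c ℚ.* d ≡ a ℚ.* (b ℚ.- d) ℚ.+ d ℚ.* (a ℚ.- c)
  mul-sub = solve 4 (λ a b c d →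
    a :* b :- c :* d := a :* (b :- d) :+ d :* (a :- c)) refl
    where open +-*-Solver

  sub-add : ∀ a b → (a ℚ.- b) ℚ.+ b ≡ a
  sub-add = solve 2 (λ a b → (a :- b) :+ b := a) refl
    where open +-*-Solver

  ∣+∣-bound : ∀ x y {a b} → ℚ.∣ x ∣ ℚ.< a → ℚ.∣ y ∣ ℚ.< b → ℚ.∣ x ℚ.+ y ∣ ℚ.< a ℚ.+ b
  ∣+∣-bound x y x<a y<b = ℚ.≤-<-trans (ℚ.∣p+q∣≤∣p∣+∣q∣ x y) (ℚ.+-mono-< x<a y<b)

  const-cauchy : ∀ q → IsCauchy (λ _ → q)
  const-cauchy q ε 0<ε = 0 , λ _ _ _ _ →
    subst (λ d → ℚ.∣ d ∣ ℚ.< ε) (sym (ℚ.+-inverseʳ q)) 0<ε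

  +-cauchy : ∀ s t → IsCauchy s → IsCauchy t → IsCauchy (λ n → s n ℚ.+ t n)
  +-cauchy s t cs ct ε 0<ε
    with cs (½ ℚ.* ε) (half-pos 0<ε) | ct (½ ℚ.* ε) (half-pos 0<ε)
  ... | M , hs | N , ht = M ℕ.⊔ N , λ m n p q →
      subst₂ ℚ._<_ (cong ℚ.∣_∣ (sym (interchange (s m) (t m) (s n) (t n)))) (half+half ε)
        (∣+∣-bound (s m ℚ.- s n) (t m ℚ.- t n)
          (hs m n (ℕ.m⊔n≤o⇒m≤o M N p) (ℕ.m⊔n≤o⇒m≤o M N q))
          (ht m n (ℕ.m⊔n≤o⇒n≤o M N p) (ℕ.m⊔n≤o⇒n≤o M N q)))

  neg-cauchy : ∀ s → IsCauchy s → IsCauchy (λ n → ℚ.- s n)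
  neg-cauchy s cs ε 0<ε with cs ε 0<ε
  ... | N , h = N , λ m n p q →
    subst (ℚ._< ε)
      (sym (trans (cong ℚ.∣_∣ (neg-sub (s m) (s n))) (ℚ.∣-p∣≡∣p∣ (s m ℚ.- s n))))
      (h m n p q)

  Bounded : (ℕ → ℚ) → Set
  Bounded s = ∃[ B ] ∃[ N ] (0ℚ ℚ.< B × (∀ n → N ℕ.≤ n → ℚ.∣ s n ∣ ℚ.< B))

  bounded : ∀ s → IsCauchy s → Bounded s
  bounded s cs with cs 1ℚ (ℚ.positive⁻¹ 1ℚ)
  ... | N , h = 1ℚ ℚ.+ ℚ.∣ s N ∣ , N
    , ℚ.+-mono-<-≤ (ℚ.positive⁻¹ 1ℚ) (ℚ.0≤∣p∣ (s N))
    , λ n p → begin-strict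
      ℚ.∣ s n ∣                        ≡⟨ cong ℚ.∣_∣ (sym (sub-add (s n) (s N))) ⟩
      ℚ.∣ (s n ℚ.- s N) ℚ.+ s N ∣      ≤⟨ ℚ.∣p+q∣≤∣p∣+∣q∣ (s n ℚ.- s N) (s N) ⟩
      ℚ.∣ s n ℚ.- s N ∣ ℚ.+ ℚ.∣ s N ∣  <⟨ ℚ.+-monoˡ-< ℚ.∣ s N ∣ (h n N p ℕ.≤-refl) ⟩
      1ℚ ℚ.+ ℚ.∣ s N ∣                 ∎
    where open ℚ.≤-Reasoning

  ∣*∣-bound : ∀ x y {A δ} → 0ℚ ℚ.< δ → ℚ.∣ x ∣ ℚ.< A → ℚ.∣ y ∣ ℚ.< δ →
    ℚ.∣ x ℚ.* y ∣ ℚ.< A ℚ.* δ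
  ∣*∣-bound x y {A} {δ} 0<δ x<A y<δ = begin-strict
    ℚ.∣ x ℚ.* y ∣      ≡⟨ ℚ.∣p*q∣≡∣p∣*∣q∣ x y ⟩
    ℚ.∣ x ∣ ℚ.* ℚ.∣ y ∣
      ≤⟨ ℚ.*-monoˡ-≤-nonNeg ℚ.∣ x ∣ {{ℚ.nonNegative (ℚ.0≤∣p∣ x)}} (ℚ.<⇒≤ y<δ) ⟩
    ℚ.∣ x ∣ ℚ.* δ      <⟨ ℚ.*-monoˡ-<-pos δ {{ℚ.positive 0<δ}} x<A ⟩
    A ℚ.* δ            ∎
    where open ℚ.≤-Reasoning

  divide : ∀ {C ε} → 0ℚ ℚ.< C → 0ℚ ℚ.< ε → ∃[ δ ] (0ℚ ℚ.< δ × C ℚ.* δ ≡ ε)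
  divide {C} {ε} 0<C 0<ε = C⁻¹ ℚ.* ε
    , subst (ℚ._< C⁻¹ ℚ.* ε) (ℚ.*-zeroʳ C⁻¹)
        (ℚ.*-monoʳ-<-pos C⁻¹ {{ℚ.1/pos⇒pos C {{ℚ.positive 0<C}}}} 0<ε)
    , trans (sym (ℚ.*-assoc C C⁻¹ ε))
        (trans (cong (ℚ._* ε) (ℚ.*-inverseʳ C {{C≢0}})) (ℚ.*-identityˡ ε))
    where
    C≢0 : ℚ.NonZero C
    C≢0 = ℚ.pos⇒nonZero C {{ℚ.positive 0<C}}
    C⁻¹ : ℚ
    C⁻¹ = (ℚ.1/ C) {{C≢0}}

  mul-close : ∀ a b c d {A B δ ε} → 0ℚ ℚ.< δ → (A ℚ.+ B) ℚ.* δ ≡ ε →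
    ℚ.∣ a ∣ ℚ.< A → ℚ.∣ d ∣ ℚ.< B → ℚ.∣ a ℚ.- c ∣ ℚ.< δ → ℚ.∣ b ℚ.- d ∣ ℚ.< δ →
    ℚ.∣ a ℚ.* b ℚ.- c ℚ.* d ∣ ℚ.< ε
  mul-close a b c d {A} {B} {δ} {ε} 0<δ eq a<A d<B a-c b-d =
    subst₂ ℚ._<_ (cong ℚ.∣_∣ (sym (mul-sub a b c d)))
      (trans (sym (ℚ.*-distribʳ-+ δ A B)) eq)
      (∣+∣-bound (a ℚ.* (b ℚ.- d)) (d ℚ.* (a ℚ.- c)) {A ℚ.* δ} {B ℚ.* δ}
        (∣*∣-bound a (b ℚ.- d) {A} {δ} 0<δ a<A b-d)
        (∣*∣-bound d (a ℚ.- c) {B} {δ} 0<δ d<B a-c))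

  *-cauchy : ∀ s t → IsCauchy s → IsCauchy t → IsCauchy (λ n → s n ℚ.* t n)
  *-cauchy s t cs ct ε 0<ε = go (bounded s cs) (bounded t ct)
    where
    go : Bounded s → Bounded t → ∃[ P ] (∀ m n → P ℕ.≤ m → P ℕ.≤ n →
           ℚ.∣ s m ℚ.* t m ℚ.- s n ℚ.* t n ∣ ℚ.< ε)
    go (A , K , 0<A , hA) (B , L , 0<B , hB) =
      close (divide {A ℚ.+ B} {ε} (ℚ.+-mono-< {0ℚ} {A} {0ℚ} {B} 0<A 0<B) 0<ε)
      where
      close : ∃[ δ ] (0ℚ ℚ.< δ × (A ℚ.+ B) ℚ.* δ ≡ ε) →
              ∃[ P ] (∀ m n → P ℕ.≤ m → P ℕ.≤ n →
                ℚ.∣ s m ℚ.* t m ℚ.- s n ℚ.* t n ∣ ℚ.< ε)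
      close (δ , 0<δ , eq) =
        let M , hs = cs δ 0<δ
            N , ht = ct δ 0<δ
        in (K ℕ.⊔ L) ℕ.⊔ (M ℕ.⊔ N) , λ m n p q →
          let p₁ = ℕ.m⊔n≤o⇒m≤o (K ℕ.⊔ L) (M ℕ.⊔ N) p
              p₂ = ℕ.m⊔n≤o⇒n≤o (K ℕ.⊔ L) (M ℕ.⊔ N) p
              q₁ = ℕ.m⊔n≤o⇒m≤o (K ℕ.⊔ L) (M ℕ.⊔ N) q
              q₂ = ℕ.m⊔n≤o⇒n≤o (K ℕ.⊔ L) (M ℕ.⊔ N) q
          in mul-close (s m) (t m) (s n) (t n) {A} {B} {δ} {ε} 0<δ eq
               (hA m (ℕ.m⊔n≤o⇒m≤o K L p₁))
               (hB n (ℕ.m⊔n≤o⇒n≤o K L q₁))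
               (hs m n (ℕ.m⊔n≤o⇒m≤o M N p₂) (ℕ.m⊔n≤o⇒m≤o M N q₂))
               (ht m n (ℕ.m⊔n≤o⇒n≤o M N p₂) (ℕ.m⊔n≤o⇒n≤o M N q₂))

open CauchyLemmas using (const-cauchy; +-cauchy; neg-cauchy; *-cauchy)

infix  8 -_
infixl 7 _*_
infixl 6 _+_ _-_
infix  4 _≈_ _<_ _≤_

fromℚ : ℚ → ℝ
fromℚ q = mkℝ (λ _ → q) (const-cauchy q)

0ℝ 1ℝ : ℝ
0ℝ = fromℚ 0ℚ
1ℝ = fromℚ 1ℚ

-- Opaque only to keep the type checker from normalising the products of
-- rationals underneath.
opaque
  -_ : ℝ → ℝ
  - x = mkℝ (λ n → ℚ.- seq x n) (neg-cauchy (seq x) (cauchy x))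

  _+_ _*_ : ℝ → ℝ → ℝ
  x + y = mkℝ (λ n → seq x n ℚ.+ seq y n) (+-cauchy (seq x) (seq y) (cauchy x) (cauchy y))
  x * y = mkℝ (λ n → seq x n ℚ.* seq y n) (*-cauchy (seq x) (seq y) (cauchy x) (cauchy y))

_-_ : ℝ → ℝ → ℝ
x - y = x + (- y)

_≈_ _<_ _≤_ : Rel ℝ 0ℓ
x ≈ y = ∀ ε → 0ℚ ℚ.< ε →
  ∃[ N ] (∀ n → N ℕ.≤ n → ℚ.∣ seq x n ℚ.- seq y n ∣ ℚ.< ε)
x < y = ∃[ ε ] (0ℚ ℚ.< ε × ∃[ N ] (∀ n → N ℕ.≤ n → seq x n ℚ.+ ε ℚ.< seq y n))
x ≤ y = ¬ (y < x)

------------------------------------------------------------------------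
-- The plane

Point : Set
Point = ℝ × ℝ

infix 4 _≈ₚ_

_≈ₚ_ : Rel Point 0ℓ
(x , y) ≈ₚ (x′ , y′) = x ≈ x′ × y ≈ y′

dist² : Point → Point → ℝ
dist² (x , y) (x′ , y′) = (x - x′) * (x - x′) + (y - y′) * (y - y′)

combine : ℝ → Point → Point → Point
combine t (x , y) (x′ , y′) = ((1ℝ - t) * x + t * x′) , ((1ℝ - t) * y + t * y′)

Convex : Pred Point 0ℓ → Set
Convex K = ∀ {p q} → p ∈ K → q ∈ K → ∀ t → 0ℝ ≤ t → t ≤ 1ℝ → combine t p q ∈ K

Open : Pred Point 0ℓ → Set
Open U = ∀ {p} → p ∈ U → ∃[ r ] (0ℝ < r × (∀ q → dist² p q < r * r → q ∈ U))

Compact : Pred Point 0ℓ → Set₁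
Compact K = (I : Set) (U : I → Pred Point 0ℓ) → (∀ i → Open (U i)) →
  K ⊆ ⋃ I U → Σ[ is ∈ List I ] (∀ {p} → p ∈ K → Any (λ i → p ∈ U i) is)

-- Since points are compared by _≈ₚ_, a predicate is a subset of the plane
-- only if it respects _≈ₚ_.
record CompactConvex (K : Pred Point 0ℓ) : Set₁ where
  field
    respects : K Respects _≈ₚ_
    compact  : Compact K
    convex   : Convex K

PairwiseIntersecting : ∀ {n} → (Fin n → Pred Point 0ℓ) → Set
PairwiseIntersecting K = ∀ i j → i ≢ j → K i ≬ K j

------------------------------------------------------------------------
-- Orientations.  The sign of a real number is not computable, so the
-- functions o(pqr) and o(ABC) are given by their graphs.

data HasSign (x : ℝ) : ℤ → Set where
  positive : 0ℝ < x → HasSign x 1ℤ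
  zero     : x ≈ 0ℝ → HasSign x 0ℤ
  negative : x < 0ℝ → HasSign x -1ℤ

-- Twice the signed area of the triangle pqr, which is positive exactly
-- when pqr is counterclockwise.
area₂ : Point → Point → Point → ℝ
area₂ (px , py) (qx , qy) (rx , ry) = (qx - px) * (ry - py) - (qy - py) * (rx - px)

-- o(pqr) = s
PointOrientation : Point → Point → Point → ℤ → Set
PointOrientation p q r s = HasSign (area₂ p q r) s

-- o(ABC) = s, for pairwise intersecting compact convex A, B, C
record SetOrientation (A B C : Pred Point 0ℓ) (s : ℤ) : Set where
  field
    common   : Satisfiable (A ∩ B ∩ C) → s ≡ 0ℤ
    disjoint : Empty (A ∩ B ∩ C) → ∀ {x y z} →
               x ∈ B ∩ C → y ∈ A ∩ C → z ∈ A ∩ B → PointOrientation x y z s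

-- o(K i, K j, K k) = o(p i, p j, p k) for all distinct i, j, k
SameOrientations : ∀ {n} → (Fin n → Pred Point 0ℓ) → (Fin n → Point) → Set
SameOrientations K p = ∀ i j k → i ≢ j → j ≢ k → i ≢ k →
  ∃[ s ] (SetOrientation (K i) (K j) (K k) s × PointOrientation (p i) (p j) (p k) s)

AllDistinct : ∀ {n} → (Fin n → Point) → Set
AllDistinct p = ∀ i j → i ≢ j → ¬ (p i ≈ₚ p j)

module Submission where

-- Take the vertices p₁, p₃, p₂, p₄ of a convex quadrilateral and the intersection
-- p₅ of its diagonals p₁p₂ and p₃p₄.  In a family K with these orientations the
-- two collinear triples yield points x ∈ K₁ ∩ K₂ ∩ K₅ and y ∈ K₃ ∩ K₄ ∩ K₅.
-- Choose p ∈ K₁ ∩ K₃, q ∈ K₂ ∩ K₄, r ∈ K₁ ∩ K₄ and s ∈ K₂ ∩ K₃.  The line xy has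
-- p and q on one side and r and s on the other, so it meets the segments
-- pr ⊆ K₁, ps ⊆ K₃, qs ⊆ K₂, qr ⊆ K₄ in points a, b, c, d.  As xy ⊆ K₅ and the
-- triple intersections with K₅ are empty, a and c both come before b and d on the
-- line directed from x to y.  But when each point is weighted by the sum of the
-- reciprocal distances to the line of the endpoints of its segment, a and c have
-- the same total weight and the same weighted sum of positions as b and d.

open import Algebra.Bundles using (CommutativeRing)
open import Algebra.Solver.Ring.AlmostCommutativeRing
  using (fromCommutativeRing; _-Raw-AlmostCommutative⟶_)
open import Algebra.Structures using (IsCommutativeRing)
open import Data.Empty using (⊥)
open import Data.Fin.Base using (Fin)
open import Data.Fin.Patterns using (0F; 1F; 2F; 3F; 4F)
open import Data.Fin.Properties using (_≟_; all?)
open import Data.Integer.Base using (ℤ; 0ℤ; 1ℤ; -1ℤ)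
open import Data.Maybe.Base as Maybe using (Maybe)
open import Data.Nat.Base as ℕ using (ℕ)
import Data.Nat.Properties as ℕ
open import Data.Product.Base using (Σ-syntax; ∃-syntax; _×_; _,_; proj₁; proj₂)
open import Data.Rational.Base as ℚ using (ℚ; 0ℚ; 1ℚ; ½)
import Data.Rational.Properties as ℚ
open import Data.Rational.Solver using (module +-*-Solver)
open import Data.Sum.Base using (inj₁; inj₂)
open import Data.Vec.Base using ([]; _∷_; lookup)
open import Level using (0ℓ)
open import Relation.Binary.Core using (Rel)
open import Relation.Binary.Definitions using (_Respects_; tri<; tri≈; tri>)
open import Relation.Binary.PropositionalEquality as ≡
  using (_≡_; _≢_; cong; subst; subst₂)
open import Relation.Binary.Structures using (IsEquivalence; IsStrictPartialOrder)
open import Relation.Nullary.Decidable using (dec⇒maybe; from-yes; yes; no; _×-dec_; _→-dec_)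
open import Relation.Nullary.Negation.Core using (¬_; contradiction)
open import Relation.Unary using (Pred; _∈_; _∩_; Empty)

-- The geometry is done over an abstract field because the equality of ℝ unfolds,
-- so that implicit arguments could not be inferred from equations between reals.
record OrderedField : Set₁ where
  field
    commutativeRing : CommutativeRing 0ℓ 0ℓ
  open CommutativeRing commutativeRing public
  infix 4 _<_
  field
    _<_                  : Rel Carrier 0ℓ
    isStrictPartialOrder : IsStrictPartialOrder _≈_ _<_
    -- Trichotomy in negative form: the order of Cauchy reals is not decidable, so case distinctions
    -- on it are made only while deriving a contradiction.
    connected            : ∀ {x y} → ¬ (x < y) → ¬ (y < x) → x ≈ y
    +-monoˡ-<            : ∀ z {x y} → x < y → x + z < y + z
    *-pos                : ∀ {x y} → 0# < x → 0# < y → 0# < x * y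
    inverse              : ∀ {x} → 0# < x → ∃[ y ] (x * y ≈ 1#)
    -- Provides coefficients with decidable equality for the ring solver.
    rationals            : ℚ.+-*-rawRing -Raw-AlmostCommutative⟶
                             fromCommutativeRing commutativeRing

module Geometry (F : OrderedField) where
  open OrderedField F
  open IsStrictPartialOrder isStrictPartialOrder
    using (irrefl; asym; <-respˡ-≈; <-respʳ-≈) renaming (trans to <-trans)
  open _-Raw-AlmostCommutative⟶_ rationals using (⟦_⟧; 0-homo)
  open import Relation.Binary.Reasoning.Setoid setoid

  equalCoefficients : ∀ p q → Maybe (⟦ p ⟧ ≈ ⟦ q ⟧)
  equalCoefficients p q =
    Maybe.map (λ p≡q → reflexive (≡.cong ⟦_⟧ p≡q)) (dec⇒maybe (p ℚ.≟ q))

  open import Algebra.Solver.Ring ℚ.+-*-rawRing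
    (fromCommutativeRing commutativeRing) rationals equalCoefficients
    using (solve; _:=_; _:+_; _:*_; _:-_; :-_; con)

  -- Order and interpolation in an ordered field.

  -cong₂ : ∀ {x y u v} → x ≈ y → u ≈ v → x - u ≈ y - v
  -cong₂ x≈y u≈v = +-cong x≈y (-‿cong u≈v)

  x-x≈0 : ∀ x → x - x ≈ 0#
  x-x≈0 = -‿inverseʳ

  0<⇒< : ∀ {d x y} → 0# < d → d ≈ y - x → x < y
  0<⇒< {d} {x} {y} 0<d d≈y-x = <-respˡ-≈ (+-identityˡ x)
    (<-respʳ-≈ (trans (+-congʳ d≈y-x) (solve 2 (λ x y → (y :- x) :+ x := y) refl x y))
      (+-monoˡ-< x 0<d))

  <⇒0< : ∀ {x y} → x < y → 0# < y - x
  <⇒0< {x} {y} x<y = <-respˡ-≈ (x-x≈0 x) (+-monoˡ-< (- x) x<y)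

  +-pos : ∀ {x y} → 0# < x → 0# < y → 0# < x + y
  +-pos {x} {y} 0<x 0<y = <-trans 0<y
    (<-respˡ-≈ (+-identityˡ y) (+-monoˡ-< y 0<x))

  neg-pos : ∀ {x} → x < 0# → 0# < - x
  neg-pos {x} x<0 = <-respʳ-≈ (+-identityˡ (- x)) (<⇒0< x<0)

  *-monoʳ-< : ∀ {c x y} → 0# < c → x < y → x * c < y * c
  *-monoʳ-< {c} {x} {y} 0<c x<y = 0<⇒< (*-pos (<⇒0< x<y) 0<c)
    (solve 3 (λ c x y → (y :- x) :* c := y :* c :- x :* c) refl c x y)

  *-cancelʳ : ∀ {c x y} → 0# < c → x * c ≈ y * c → x ≈ y
  *-cancelʳ 0<c xc≈yc = connected
    (λ x<y → irrefl xc≈yc (*-monoʳ-< 0<c x<y))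
    (λ y<x → irrefl (sym xc≈yc) (*-monoʳ-< 0<c y<x))

  -- If `x < z` fails, so does `z < x`, since it would give `z < y`; then `connected` makes `x` and
  -- `z` equal. The double negation is harmless because every use aims at `⊥`.
  ¬¬-<-≤-trans : ∀ {x y z} → x < y → ¬ (z < y) → ¬ ¬ (x < z)
  ¬¬-<-≤-trans x<y z≮y x≮z =
    z≮y (<-respˡ-≈ (connected x≮z (λ z<x → z≮y (<-trans z<x x<y))) x<y)

  ¬¬-≤-<-trans : ∀ {x y z} → ¬ (y < x) → y < z → ¬ ¬ (x < z)
  ¬¬-≤-<-trans y≮x y<z x≮z =
    y≮x (<-respʳ-≈ (sym (connected x≮z (λ z<x → y≮x (<-trans y<z z<x)))) y<z)

  ratio : ∀ {n d} → 0# < d → ¬ (n < 0#) → ¬ (d < n) →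
          ∃[ t ] (¬ (t < 0#) × ¬ (1# < t) × t * d ≈ n)
  ratio {n} {d} 0<d n≮0 d≮n = n * d⁻¹
    , (λ t<0 → n≮0 (<-respˡ-≈ t*d≈n (<-respʳ-≈ (zeroˡ d) (*-monoʳ-< 0<d t<0))))
    , (λ 1<t → d≮n (<-respˡ-≈ (*-identityˡ d) (<-respʳ-≈ t*d≈n (*-monoʳ-< 0<d 1<t))))
    , t*d≈n
    where
    d⁻¹ : Carrier
    d⁻¹ = proj₁ (inverse 0<d)
    t*d≈n : n * d⁻¹ * d ≈ n
    t*d≈n = begin
      n * d⁻¹ * d    ≈⟨ solve 3 (λ n i d → n :* i :* d := n :* (d :* i)) refl n d⁻¹ d ⟩
      n * (d * d⁻¹)  ≈⟨ *-congˡ (proj₂ (inverse 0<d)) ⟩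
      n * 1#         ≈⟨ *-identityʳ n ⟩
      n              ∎

  interpolate : ∀ {u v w} → u < w → ¬ (v < u) → ¬ (w < v) →
    ∃[ t ] (¬ (t < 0#) × ¬ (1# < t) × u + t * (w - u) ≈ v)
  interpolate {u} {v} {w} u<w v≮u w≮v =
    let t , t≮0 , 1≮t , t*d≈n = ratio (<⇒0< u<w)
          (λ n<0 → v≮u (0<⇒< (neg-pos n<0) (solve 2 (λ u v → :- (v :- u) := u :- v) refl u v)))
          (λ d<n → w≮v (0<⇒< (<⇒0< d<n)
            (solve 3 (λ u v w → (v :- u) :- (w :- u) := v :- w) refl u v w)))
    in t , t≮0 , 1≮t , trans (+-congˡ t*d≈n) (solve 2 (λ u v → u :+ (v :- u) := v) refl u v)

  -- The last clause gives any other interpolated quantity at the zero as the mean of its end values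
  -- with weights `q` and `- p`. It is multiplied out so that later identities stay polynomial.
  zero-crossing : ∀ {p q} → p < 0# → 0# < q →
    ∃[ t ] (¬ (t < 0#) × ¬ (1# < t) × p + t * (q - p) ≈ 0# ×
      (∀ g h → (g + t * (h - g)) * (- p + q) ≈ q * g + - p * h))
  zero-crossing {p} {q} p<0 0<q =
    let t , t≮0 , 1≮t , zero≈ = interpolate (<-trans p<0 0<q) (asym p<0) (asym 0<q) in
    t , t≮0 , 1≮t , zero≈ , λ g h → begin
      -- The two sides differ by `h - g` times the interpolated value at the zero.
      (g + t * (h - g)) * (- p + q)
        ≈⟨ solve 5 (λ t p q g h → (g :+ t :* (h :- g)) :* ((:- p) :+ q)
             := (q :* g :+ (:- p) :* h) :+ (p :+ t :* (q :- p)) :* (h :- g)) refl t p q g h ⟩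
      (q * g + - p * h) + (p + t * (q - p)) * (h - g)
        ≈⟨ +-congˡ (trans (*-congʳ zero≈) (zeroˡ (h - g))) ⟩
      (q * g + - p * h) + 0#
        ≈⟨ +-identityʳ _ ⟩
      q * g + - p * h ∎

  square-pos : ∀ {a} → ¬ (a ≈ 0#) → ¬ ¬ (0# < a * a)
  square-pos {a} a≉0 a²≯0 = a≉0 (connected
    (λ a<0 → a²≯0 (<-respʳ-≈ (solve 1 (λ a → (:- a) :* (:- a) := a :* a) refl a)
      (*-pos (neg-pos a<0) (neg-pos a<0))))
    (λ 0<a → a²≯0 (*-pos 0<a 0<a)))

  -- By `connected`, `a ≈ 0#` follows from its double negation, so `a` may be assumed nonzero; then
  -- the sum is positive whether or not `b` vanishes.
  sum-of-squares : ∀ {a b} → ¬ (0# < a * a + b * b) → a ≈ 0#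
  sum-of-squares {a} {b} s≯0 = connected (λ a<0 → a≈0-stable (λ a≈0 → irrefl a≈0 a<0))
    (λ 0<a → a≈0-stable (λ a≈0 → irrefl (sym a≈0) 0<a))
    where
    a≈0-stable : ¬ ¬ (a ≈ 0#)
    a≈0-stable a≉0 = square-pos a≉0 λ 0<a² → square-pos
      (λ b≈0 → s≯0 (<-respʳ-≈ (sym (trans
        (+-congˡ (trans (*-cong b≈0 b≈0) (zeroˡ 0#))) (+-identityʳ (a * a)))) 0<a²))
      (λ 0<b² → s≯0 (+-pos 0<a² 0<b²))

  -- Points and lines

  Pt : Set
  Pt = Carrier × Carrier

  infix 4 _≈ₚ_

  _≈ₚ_ : Rel Pt 0ℓ
  (x , y) ≈ₚ (x′ , y′) = x ≈ x′ × y ≈ y′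

  combine : Carrier → Pt → Pt → Pt
  combine t (x , y) (x′ , y′) = ((1# - t) * x + t * x′) , ((1# - t) * y + t * y′)

  area₂ : Pt → Pt → Pt → Carrier
  area₂ (px , py) (qx , qy) (rx , ry) = (qx - px) * (ry - py) - (qy - py) * (rx - px)

  record IsConvexSet (K : Pred Pt 0ℓ) : Set where
    field
      respects : K Respects _≈ₚ_
      convex   : ∀ {p q} → p ∈ K → q ∈ K → ∀ t → ¬ (t < 0#) → ¬ (1# < t) → combine t p q ∈ K

  open IsConvexSet

  combine-as-shift : ∀ t x y → (1# - t) * x + t * y ≈ x + t * (y - x)
  combine-as-shift t x y = trans
    (solve 4 (λ one t x y → (one :- t) :* x :+ t :* y := one :* x :+ t :* (y :- x)) refl 1# t x y)
    (+-congʳ (*-identityˡ x))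

  area₂-degenerate : ∀ {x y} → x ≈ₚ y → ∀ p → area₂ x y p ≈ 0#
  area₂-degenerate {x₁ , x₂} {y₁ , y₂} (x₁≈y₁ , x₂≈y₂) (p₁ , p₂) = trans
    (-cong₂ (*-congʳ (-cong₂ (sym x₁≈y₁) refl)) (*-congʳ (-cong₂ (sym x₂≈y₂) refl)))
    (trans (solve 4 (λ x₁ x₂ p₁ p₂ →
        (x₁ :- x₁) :* (p₂ :- x₂) :- (x₂ :- x₂) :* (p₁ :- x₁) := con 0ℚ) refl x₁ x₂ p₁ p₂)
      0-homo)

  length² : Pt → Pt → Carrier
  length² (x₁ , x₂) (y₁ , y₂) = (y₁ - x₁) * (y₁ - x₁) + (y₂ - x₂) * (y₂ - x₂)

  -- Were the sum of squares not positive, both coordinate differences would vanish. This replaces a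
  -- decision whether `x` and `y` coincide.
  length²-pos : ∀ {x y} → ¬ (x ≈ₚ y) → ¬ ¬ (0# < length² x y)
  length²-pos {x₁ , x₂} {y₁ , y₂} x≉y ℓ≯0 = x≉y
    ( equal (sum-of-squares ℓ≯0)
    , equal (sum-of-squares (λ 0<s → ℓ≯0 (<-respʳ-≈ (+-comm _ _) 0<s))))
    where
    equal : ∀ {a b} → b - a ≈ 0# → a ≈ b
    equal {a} {b} b-a≈0 = sym (trans (solve 2 (λ a b → b := (b :- a) :+ a) refl a b)
      (trans (+-congʳ b-a≈0) (+-identityˡ a)))

  -- Coordinates along and across the line xy: a point p is determined by its
  -- position and its height.
  module Line (x y : Pt) (0<ℓ : 0# < length² x y) where
    x₁ x₂ e₁ e₂ ℓ : Carrier
    x₁ = proj₁ x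
    x₂ = proj₂ x
    e₁ = proj₁ y - x₁
    e₂ = proj₂ y - x₂
    ℓ  = length² x y

    -- Inner and cross product of `p - x` with the direction vector: the usual coordinates scaled by
    -- the length of `xy`, which avoids a square root.
    position height : Pt → Carrier
    position (p₁ , p₂) = e₁ * (p₁ - x₁) + e₂ * (p₂ - x₂)
    height = area₂ x y

    position-x : position x ≈ 0#
    position-x = trans (solve 4 (λ x₁ x₂ e₁ e₂ →
      e₁ :* (x₁ :- x₁) :+ e₂ :* (x₂ :- x₂) := con 0ℚ) refl x₁ x₂ e₁ e₂) 0-homo

    height-x : height x ≈ 0#
    height-x = trans (solve 4 (λ x₁ x₂ e₁ e₂ →
      e₁ :* (x₂ :- x₂) :- e₂ :* (x₁ :- x₁) := con 0ℚ) refl x₁ x₂ e₁ e₂) 0-homo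

    height-y : height y ≈ 0#
    height-y = trans (solve 2 (λ e₁ e₂ → e₁ :* e₂ :- e₂ :* e₁ := con 0ℚ) refl e₁ e₂) 0-homo

    scaled-shift : ∀ e t p q o →
      e * ((1# - t) * p + t * q - o) ≈ e * (p - o) + t * (e * (q - o) - e * (p - o))
    scaled-shift e t p q o = trans (*-congˡ (-cong₂ (combine-as-shift t p q) refl))
      (solve 5 (λ e t p q o → e :* ((p :+ t :* (q :- p)) :- o)
        := e :* (p :- o) :+ t :* (e :* (q :- o) :- e :* (p :- o))) refl e t p q o)

    position-combine : ∀ t p q →
      position (combine t p q) ≈ position p + t * (position q - position p)
    position-combine t (p₁ , p₂) (q₁ , q₂) = trans
      (+-cong (scaled-shift e₁ t p₁ q₁ x₁) (scaled-shift e₂ t p₂ q₂ x₂))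
      (solve 5 (λ t a b c d →
        (a :+ t :* (b :- a)) :+ (c :+ t :* (d :- c)) := (a :+ c) :+ t :* ((b :+ d) :- (a :+ c)))
        refl t (e₁ * (p₁ - x₁)) (e₁ * (q₁ - x₁)) (e₂ * (p₂ - x₂)) (e₂ * (q₂ - x₂)))

    height-combine : ∀ t p q →
      height (combine t p q) ≈ height p + t * (height q - height p)
    height-combine t (p₁ , p₂) (q₁ , q₂) = trans
      (-cong₂ (scaled-shift e₁ t p₂ q₂ x₂) (scaled-shift e₂ t p₁ q₁ x₁))
      (solve 5 (λ t a b c d →
        (a :+ t :* (b :- a)) :- (c :+ t :* (d :- c)) := (a :- c) :+ t :* ((b :- d) :- (a :- c)))
        refl t (e₁ * (p₂ - x₂)) (e₁ * (q₂ - x₂)) (e₂ * (p₁ - x₁)) (e₂ * (q₁ - x₁)))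

    -- Up to translation the coordinates are a linear map with rows `e₁, e₂` and `- e₂, e₁`, of
    -- determinant `ℓ`. `first` and `second` apply its adjugate, and `ℓ` cancels.
    coordinates-injective : ∀ {p q} → position p ≈ position q → height p ≈ height q → p ≈ₚ q
    coordinates-injective {p} {q} pos≈ height≈ =
      *-cancelʳ 0<ℓ (trans (first p) (trans
        (+-congʳ (-cong₂ (*-congˡ pos≈) (*-congˡ height≈))) (sym (first q)))) ,
      *-cancelʳ 0<ℓ (trans (second p) (trans
        (+-congʳ (+-cong (*-congˡ pos≈) (*-congˡ height≈))) (sym (second q))))
      where
      first : ∀ p → proj₁ p * ℓ ≈ (e₁ * position p - e₂ * height p) + x₁ * ℓ
      first (p₁ , p₂) = solve 6 (λ x₁ x₂ e₁ e₂ p₁ p₂ →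
        p₁ :* (e₁ :* e₁ :+ e₂ :* e₂) :=
          (e₁ :* (e₁ :* (p₁ :- x₁) :+ e₂ :* (p₂ :- x₂))
            :- e₂ :* (e₁ :* (p₂ :- x₂) :- e₂ :* (p₁ :- x₁)))
          :+ x₁ :* (e₁ :* e₁ :+ e₂ :* e₂)) refl x₁ x₂ e₁ e₂ p₁ p₂

      second : ∀ p → proj₂ p * ℓ ≈ (e₂ * position p + e₁ * height p) + x₂ * ℓ
      second (p₁ , p₂) = solve 6 (λ x₁ x₂ e₁ e₂ p₁ p₂ →
        p₂ :* (e₁ :* e₁ :+ e₂ :* e₂) :=
          (e₂ :* (e₁ :* (p₁ :- x₁) :+ e₂ :* (p₂ :- x₂))
            :+ e₁ :* (e₁ :* (p₂ :- x₂) :- e₂ :* (p₁ :- x₁)))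
          :+ x₂ :* (e₁ :* e₁ :+ e₂ :* e₂)) refl x₁ x₂ e₁ e₂ p₁ p₂

    -- The convex combination of `u` and `w` at the parameter read off the positions has the
    -- coordinates of `v`, hence is the point `v`.
    between : ∀ {K u v w} → IsConvexSet K → u ∈ K → w ∈ K →
      height u ≈ 0# → height v ≈ 0# → height w ≈ 0# →
      position u < position w → ¬ (position v < position u) → ¬ (position w < position v) →
      v ∈ K
    between {K} {u} {v} {w} K-convex u∈K w∈K hu hv hw u<w v≮u w≮v =
      let t , t≮0 , 1≮t , shift≈v = interpolate u<w v≮u w≮v in
      respects K-convex
        (coordinates-injective
          (trans (position-combine t u w) shift≈v)
          (trans (height-combine t u w) (trans
            (+-cong hu (*-congˡ (trans (-cong₂ hw hu) (x-x≈0 0#))))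
            (trans (+-identityˡ (t * 0#)) (trans (zeroʳ t) (sym hv))))))
        (convex K-convex u∈K w∈K t t≮0 1≮t)

    -- The last component places the crossing at the mean of the end positions, each endpoint
    -- weighted by the distance of the other one from the line, with denominators cleared.
    Crossing : Pred Pt 0ℓ → Pt → Pt → Set
    Crossing K p q = ∃[ a ] (a ∈ K × height a ≈ 0# ×
      position a * (- height p + height q) ≈ height q * position p + - height p * position q)

    crossing : ∀ {K p q} → IsConvexSet K → p ∈ K → q ∈ K →
      height p < 0# → 0# < height q → Crossing K p q
    crossing {K} {p} {q} K-convex p∈K q∈K hp<0 0<hq =
      let t , t≮0 , 1≮t , height≈0 , weighted = zero-crossing hp<0 0<hq in
      combine t p q
      , convex K-convex p∈K q∈K t t≮0 1≮t
      , trans (height-combine t p q) height≈0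
      , trans (*-congʳ (position-combine t p q)) (weighted (position p) (position q))

    -- Otherwise one of x, a, y would be common to A, B and E.
    crossings-ordered : ∀ {A B E a b} → IsConvexSet A → IsConvexSet B → IsConvexSet E →
      x ∈ A → x ∈ E → y ∈ B → y ∈ E → a ∈ A → b ∈ B → height a ≈ 0# → height b ≈ 0# →
      Empty (B ∩ A ∩ E) → ¬ ¬ (position a < position b)
    crossings-ordered {A} {B} {E} {a} {b} cA cB cE x∈A x∈E y∈B y∈E a∈A b∈B ha hb empty a≮b =
      a-before-y λ a<y → a-before-x a<y λ a<x → a-not-before-x a<x
      where
      x<y : position x < position y
      -- `position y` unfolds to `ℓ`.
      x<y = <-respˡ-≈ (sym position-x) 0<ℓ

      a-before-y : ¬ ¬ (position a < position y)
      -- With `y` at or before `a`, the point `y` lies between `x` and `a`, hence in `A`.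
      a-before-y a≮y = ¬¬-<-≤-trans x<y a≮y λ x<a → empty y
        ( y∈B
        , between cA x∈A a∈A height-x height-y ha x<a (asym x<y) a≮y
        , y∈E)

      a-before-x : position a < position y → ¬ ¬ (position a < position x)
      -- Here `a` lies between `b` and `y`, hence in `B`, and between `x` and `y`, hence in `E`.
      a-before-x a<y a≮x = ¬¬-≤-<-trans a≮b a<y λ b<y → empty a
        ( between cB b∈B y∈B hb ha height-y b<y a≮b (asym a<y)
        , a∈A
        , between cE x∈E y∈E height-x ha height-y x<y a≮x (asym a<y))

      a-not-before-x : ¬ (position a < position x)
      -- Here `x` lies between `b` and `y`, hence in `B`.
      a-not-before-x a<x = ¬¬-≤-<-trans a≮b a<x λ b<x → empty x
        ( between cB b∈B y∈B hb height-x height-y (<-trans b<x x<y) (asym b<x) (asym x<y)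
        , x∈A
        , x∈E)

  -- One of the three points lies between the other two, hence in all three sets.
  collinear⇒common : ∀ {A B C x y z} → IsConvexSet A → IsConvexSet B → IsConvexSet C →
    x ∈ B ∩ C → y ∈ A ∩ C → z ∈ A ∩ B → area₂ x y z ≈ 0# → ¬ Empty (A ∩ B ∩ C)
  collinear⇒common {A} {B} {C} {x} {y} {z} cA cB cC (x∈B , x∈C) (y∈A , y∈C) (z∈A , z∈B) hz empty =
    -- If `x` and `y` coincide, they form a common point; otherwise they span a line, which contains
    -- `z`.
    length²-pos
      (λ (x₁≈y₁ , x₂≈y₂) → empty x (respects cA (sym x₁≈y₁ , sym x₂≈y₂) y∈A , x∈B , x∈C))
      onLine
    where
    onLine : ¬ (0# < length² x y)
    onLine 0<ℓ = empty z
      ( z∈A , z∈B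
      , between cC x∈C y∈C height-x hz height-y x<y z≮x y≮z)
      where
      open Line x y 0<ℓ
      x<y : position x < position y
      x<y = <-respˡ-≈ (sym position-x) 0<ℓ

      z≮x : ¬ (position z < position x)
      z≮x z<x = empty x
        ( between cA z∈A y∈A hz height-x height-y (<-trans z<x x<y) (asym z<x) (asym x<y)
        , x∈B , x∈C)

      y≮z : ¬ (position y < position z)
      y≮z y<z = empty y
        ( y∈A
        , between cB x∈B z∈B height-x height-y hz (<-trans x<y y<z) (asym x<y) (asym y<z)
        , y∈C)

  -- Weighted positions of the four crossings.

  no-interlacing : ∀ {A B C D α β γ δ} → 0# < A → 0# < B → 0# < C → 0# < D →
    A + C ≈ B + D → A * α + C * γ ≈ B * β + D * δ →
    α < β → α < δ → γ < β → ¬ (γ < δ)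
  no-interlacing {A} {B} {C} {D} {α} {β} {γ} {δ} 0<A 0<B 0<C 0<D A+C≈B+D sums≈ α<β α<δ γ<β γ<δ =
    -- Equal weights and moments make the two products equal, yet their difference expands into four
    -- positive terms, one for each gap from `α` or `γ` to `β` or `δ`.
    irrefl (trans (*-congˡ sums≈) (*-congʳ (sym A+C≈B+D)))
      (0<⇒<
        (+-pos (+-pos (*-pos (*-pos 0<A 0<B) (<⇒0< α<β)) (*-pos (*-pos 0<A 0<D) (<⇒0< α<δ)))
               (+-pos (*-pos (*-pos 0<C 0<B) (<⇒0< γ<β)) (*-pos (*-pos 0<C 0<D) (<⇒0< γ<δ))))
        (solve 8 (λ A B C D α β γ δ →
          ((A :* B) :* (β :- α) :+ (A :* D) :* (δ :- α))
            :+ ((C :* B) :* (β :- γ) :+ (C :* D) :* (δ :- γ))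
          := (A :+ C) :* (B :* β :+ D :* δ) :- (B :+ D) :* (A :* α :+ C :* γ))
          refl A B C D α β γ δ))

  -- The hypotheses say that α, β, γ, δ are the positions at which the segments
  -- pr, ps, qs, qr cross a line, for points at depths p, q below it, at heights
  -- r, s above it, and at positions gp, gq, gr, gs along it.
  quadrilateral-crossings : ∀ {p q r s gp gq gr gs α β γ δ} →
    0# < p → 0# < q → 0# < r → 0# < s →
    α * (p + r) ≈ r * gp + p * gr → β * (p + s) ≈ s * gp + p * gs →
    γ * (q + s) ≈ s * gq + q * gs → δ * (q + r) ≈ r * gq + q * gr →
    α < β → α < δ → γ < β → ¬ (γ < δ)
  quadrilateral-crossings {p} {q} {r} {s} {gp} {gq} {gr} {gs} {α} {β} {γ} {δ}
    0<p 0<q 0<r 0<s eqα eqβ eqγ eqδ = no-interlacing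
      -- Each weight is the sum of the reciprocals of the two end heights, multiplied by `pqrs`; for
      -- `pr` this is `qs(p + r)`.
      (*-pos (*-pos 0<q 0<s) (+-pos 0<p 0<r)) (*-pos (*-pos 0<q 0<r) (+-pos 0<p 0<s))
      (*-pos (*-pos 0<p 0<r) (+-pos 0<q 0<s)) (*-pos (*-pos 0<p 0<s) (+-pos 0<q 0<r))
      (solve 4 (λ p q r s →
        (q :* s) :* (p :+ r) :+ (p :* r) :* (q :+ s)
          := (q :* r) :* (p :+ s) :+ (p :* s) :* (q :+ r)) refl p q r s)
      -- Both moments equal `pqrs(gp/p + gq/q + gr/r + gs/s)`.
      (begin
        (q * s) * (p + r) * α + (p * r) * (q + s) * γ
          ≈⟨ +-cong (regroup eqα) (regroup eqγ) ⟩
        (q * s) * (r * gp + p * gr) + (p * r) * (s * gq + q * gs)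
          ≈⟨ solve 8 (λ p q r s gp gq gr gs →
               (q :* s) :* (r :* gp :+ p :* gr) :+ (p :* r) :* (s :* gq :+ q :* gs)
                 := (q :* r) :* (s :* gp :+ p :* gs) :+ (p :* s) :* (r :* gq :+ q :* gr))
               refl p q r s gp gq gr gs ⟩
        (q * r) * (s * gp + p * gs) + (p * s) * (r * gq + q * gr)
          ≈⟨ sym (+-cong (regroup eqβ) (regroup eqδ)) ⟩
        (q * r) * (p + s) * β + (p * s) * (q + r) * δ ∎)
    where
    regroup : ∀ {u v w k} → w * v ≈ k → u * v * w ≈ u * k
    regroup {u} {v} {w} eq =
      trans (solve 3 (λ u v w → u :* v :* w := u :* (w :* v)) refl u v w) (*-congˡ eq)

  -- `A` to `E` are the five sets in order. By the signs, `pr`, `ps`, `qs`, `qr` join opposite sides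
  -- of the line `xy`, so they cross it in points of `A`, `C`, `B`, `D` respectively.
  crossing-family-impossible : ∀ {A B C D E x y p q r s} →
    IsConvexSet A → IsConvexSet B → IsConvexSet C → IsConvexSet D → IsConvexSet E →
    Empty (C ∩ A ∩ E) → Empty (D ∩ A ∩ E) → Empty (C ∩ B ∩ E) → Empty (D ∩ B ∩ E) →
    x ∈ A ∩ B ∩ E → y ∈ C ∩ D ∩ E →
    p ∈ C ∩ A → q ∈ D ∩ B → r ∈ D ∩ A → s ∈ C ∩ B →
    area₂ x y p < 0# → area₂ x y q < 0# → 0# < area₂ x y r → ¬ (0# < area₂ x y s)
  crossing-family-impossible {x = x} {y} {p} {q} {r} {s} cA cB cC cD cE CAE DAE CBE DBE
    (x∈A , x∈B , x∈E) (y∈C , y∈D , y∈E) (p∈C , p∈A) (q∈D , q∈B) (r∈D , r∈A) (s∈C , s∈B)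
    p<0 q<0 0<r 0<s =
    -- Coinciding `x` and `y` would make the area with `p` zero.
    length²-pos (λ x≈y → irrefl (area₂-degenerate x≈y p) p<0) onLine
    where
    onLine : ¬ (0# < length² x y)
    onLine 0<ℓ =
      let open Line x y 0<ℓ
          a , a∈A , ha , eqa = crossing cA p∈A r∈A p<0 0<r
          b , b∈C , hb , eqb = crossing cC p∈C s∈C p<0 0<s
          c , c∈B , hc , eqc = crossing cB q∈B s∈B q<0 0<s
          d , d∈D , hd , eqd = crossing cD q∈D r∈D q<0 0<r
      in
      -- The four orderings come doubly negated and are chained towards `⊥`.
      crossings-ordered cA cC cE x∈A x∈E y∈C y∈E a∈A b∈C ha hb CAE λ a<b →
      crossings-ordered cA cD cE x∈A x∈E y∈D y∈E a∈A d∈D ha hd DAE λ a<d →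
      crossings-ordered cB cC cE x∈B x∈E y∈C y∈E c∈B b∈C hc hb CBE λ c<b →
      crossings-ordered cB cD cE x∈B x∈E y∈D y∈E c∈B d∈D hc hd DBE λ c<d →
      quadrilateral-crossings (neg-pos p<0) (neg-pos q<0) 0<r 0<s eqa eqb eqc eqd a<b a<d c<b c<d

-- The ordered field of Cauchy reals

open import Defs
open ≡ using (refl; sym; trans)
open CauchyLemmas using (half-pos; half+half; ∣+∣-bound; bounded; divide; mul-close)

module _ where
  open +-*-Solver

  <⇒0< : ∀ {p q} → p ℚ.< q → 0ℚ ℚ.< q ℚ.- p
  <⇒0< {p} {q} p<q =
    subst (ℚ._< q ℚ.- p) (ℚ.+-inverseʳ p) (ℚ.+-monoˡ-< (ℚ.- p) p<q)

  <-by-difference : ∀ {p q r s} → p ℚ.< q → q ℚ.- p ≡ s ℚ.- r → r ℚ.< s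
  <-by-difference {p} {q} {r} {s} p<q eq =
    subst₂ ℚ._<_ (ℚ.+-identityˡ r)
      (solve 2 (λ s r → s :- r :+ r := s) refl s r)
      (ℚ.+-monoˡ-< r (subst (0ℚ ℚ.<_) eq (<⇒0< p<q)))

  ∣∣<⇒< : ∀ p q {ε} → ℚ.∣ p ℚ.- q ∣ ℚ.< ε → p ℚ.< q ℚ.+ ε
  ∣∣<⇒< p q {ε} h = <-by-difference (ℚ.≤-<-trans (p≤∣p∣ (p ℚ.- q)) h)
    (solve 3 (λ p q e → e :- (p :- q) := (q :+ e) :- p) refl p q ε)
    where
    p≤∣p∣ : ∀ r → r ℚ.≤ ℚ.∣ r ∣
    p≤∣p∣ r with ℚ.≤-total 0ℚ r
    ... | inj₁ 0≤r = ℚ.≤-reflexive (sym (ℚ.0≤p⇒∣p∣≡p 0≤r))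
    ... | inj₂ r≤0 = ℚ.≤-trans r≤0 (ℚ.0≤∣p∣ r)

  ∣-∣-comm : ∀ p q → ℚ.∣ p ℚ.- q ∣ ≡ ℚ.∣ q ℚ.- p ∣
  ∣-∣-comm p q = trans (sym (ℚ.∣-p∣≡∣p∣ (p ℚ.- q)))
    (cong ℚ.∣_∣ (solve 2 (λ p q → :- (p :- q) := q :- p) refl p q))

  <⇒∣∣< : ∀ {p q ε} → p ℚ.< q ℚ.+ ε → q ℚ.< p ℚ.+ ε → ℚ.∣ p ℚ.- q ∣ ℚ.< ε
  <⇒∣∣< {p} {q} {ε} p<q+ε q<p+ε with ℚ.∣p∣≡p∨∣p∣≡-p (p ℚ.- q)
  ... | inj₁ eq = subst (ℚ._< ε) (sym eq) (<-by-difference p<q+ε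
          (solve 3 (λ p q e → (q :+ e) :- p := e :- (p :- q)) refl p q ε))
  ... | inj₂ eq = subst (ℚ._< ε) (sym eq) (<-by-difference q<p+ε
          (solve 3 (λ p q e → (p :+ e) :- q := e :- (:- (p :- q))) refl p q ε))

  half< : ∀ {ε} → 0ℚ ℚ.< ε → ½ ℚ.* ε ℚ.< ε
  half< {ε} 0<ε = <-by-difference (half-pos 0<ε)
    (trans (solve 1 (λ h → h :- con 0ℚ := (h :+ h) :- h) refl (½ ℚ.* ε))
      (cong (ℚ._- ½ ℚ.* ε) (half+half ε)))

*-pos-ℚ : ∀ {p q} → 0ℚ ℚ.< p → 0ℚ ℚ.< q → 0ℚ ℚ.< p ℚ.* q
*-pos-ℚ {p} {q} 0<p 0<q = subst (ℚ._< p ℚ.* q) (ℚ.*-zeroʳ p)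
  (ℚ.*-monoʳ-<-pos p {{ℚ.positive 0<p}} 0<q)

-- Eventual properties and the ring structure on Cauchy sequences.

Eventually : (ℕ → Set) → Set
Eventually P = ∃[ N ] (∀ n → N ℕ.≤ n → P n)

module _ {P Q : ℕ → Set} where

  eventually-map : (∀ {n} → P n → Q n) → Eventually P → Eventually Q
  eventually-map f (N , h) = N , λ n N≤n → f (h n N≤n)

  eventually-zip : ∀ {R : ℕ → Set} → (∀ {n} → P n → Q n → R n) →
                   Eventually P → Eventually Q → Eventually R
  eventually-zip f (M , g) (N , h) = M ℕ.⊔ N , λ n M⊔N≤n →
    f (g n (ℕ.m⊔n≤o⇒m≤o M N M⊔N≤n)) (h n (ℕ.m⊔n≤o⇒n≤o M N M⊔N≤n))

eventually-constant : ∀ {A : Set} → Eventually (λ _ → A) → A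
eventually-constant (N , h) = h N ℕ.≤-refl

≈-pointwise : ∀ {x y} → (∀ n → seq x n ≡ seq y n) → x ≈ y
≈-pointwise {x} {y} eq ε 0<ε = 0 , λ n _ →
  subst (λ q → ℚ.∣ q ∣ ℚ.< ε)
    (sym (trans (cong (ℚ._- seq y n) (eq n)) (ℚ.+-inverseʳ (seq y n)))) 0<ε

≈-refl : ∀ {x} → x ≈ x
≈-refl {x} = ≈-pointwise {x} {x} λ _ → refl

≈-sym : ∀ {x y} → x ≈ y → y ≈ x
≈-sym {x} {y} x≈y ε 0<ε = eventually-map
  (λ {n} → subst (ℚ._< ε) (∣-∣-comm (seq x n) (seq y n))) (x≈y ε 0<ε)

≈-trans : ∀ {x y z} → x ≈ y → y ≈ z → x ≈ z
≈-trans {x} {y} {z} x≈y y≈z ε 0<ε = eventually-zip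
  (λ {n} p q → subst₂ ℚ._<_
    (cong ℚ.∣_∣ (solve 3 (λ x y z → (x :- y) :+ (y :- z) := x :- z) refl
      (seq x n) (seq y n) (seq z n)))
    (half+half ε) (∣+∣-bound (seq x n ℚ.- seq y n) (seq y n ℚ.- seq z n) p q))
  (x≈y (½ ℚ.* ε) (half-pos 0<ε)) (y≈z (½ ℚ.* ε) (half-pos 0<ε))
  where open +-*-Solver

≈-isEquivalence : IsEquivalence _≈_
≈-isEquivalence = record
  { refl  = λ {x} → ≈-refl {x}
  ; sym   = λ {x y} → ≈-sym {x} {y}
  ; trans = λ {x y z} → ≈-trans {x} {y} {z}
  }

opaque
  unfolding _+_ _*_ -_

  +-cong : ∀ {x y u v} → x ≈ y → u ≈ v → x + u ≈ y + v
  +-cong {x} {y} {u} {v} x≈y u≈v ε 0<ε = eventually-zip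
    (λ {n} p q → subst₂ ℚ._<_
      (cong ℚ.∣_∣ (sym (CauchyLemmas.interchange (seq x n) (seq u n) (seq y n) (seq v n))))
      (half+half ε) (∣+∣-bound (seq x n ℚ.- seq y n) (seq u n ℚ.- seq v n) p q))
    (x≈y (½ ℚ.* ε) (half-pos 0<ε)) (u≈v (½ ℚ.* ε) (half-pos 0<ε))

  -‿cong : ∀ {x y} → x ≈ y → - x ≈ - y
  -‿cong {x} {y} x≈y ε 0<ε = eventually-map
    (λ {n} → subst (ℚ._< ε) (sym (trans
      (cong ℚ.∣_∣ (CauchyLemmas.neg-sub (seq x n) (seq y n)))
      (ℚ.∣-p∣≡∣p∣ (seq x n ℚ.- seq y n)))))
    (x≈y ε 0<ε)

  -- The estimate behind the Cauchy property of products, with two pairs of sequences in place of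
  -- two indices: bounds on `x` and `v` suffice, and `δ` is `ε` divided by their sum.
  *-cong : ∀ {x y u v} → x ≈ y → u ≈ v → x * u ≈ y * v
  *-cong {x} {y} {u} {v} x≈y u≈v ε 0<ε =
    let A , K , 0<A , hA = bounded (seq x) (cauchy x)
        B , L , 0<B , hB = bounded (seq v) (cauchy v)
        δ , 0<δ , eq     = divide {A ℚ.+ B} {ε} (ℚ.+-mono-< {0ℚ} {A} {0ℚ} {B} 0<A 0<B) 0<ε
    in eventually-zip
         (λ {n} (a , d) (a-c , b-d) →
           mul-close (seq x n) (seq u n) (seq y n) (seq v n) {A} {B} {δ} {ε} 0<δ eq a d a-c b-d)
         (eventually-zip _,_ (K , hA) (L , hB))
         (eventually-zip _,_ (x≈y δ 0<δ) (u≈v δ 0<δ))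

  +-assoc : ∀ x y z → (x + y) + z ≈ x + (y + z)
  +-assoc x y z = ≈-pointwise {(x + y) + z} {x + (y + z)}
    λ n → ℚ.+-assoc (seq x n) (seq y n) (seq z n)

  +-comm : ∀ x y → x + y ≈ y + x
  +-comm x y = ≈-pointwise {x + y} {y + x} λ n → ℚ.+-comm (seq x n) (seq y n)

  +-identityˡ : ∀ x → 0ℝ + x ≈ x
  +-identityˡ x = ≈-pointwise {0ℝ + x} {x} λ n → ℚ.+-identityˡ (seq x n)

  -‿inverseˡ : ∀ x → - x + x ≈ 0ℝ
  -‿inverseˡ x = ≈-pointwise { - x + x} {0ℝ} λ n → ℚ.+-inverseˡ (seq x n)

  *-assoc : ∀ x y z → (x * y) * z ≈ x * (y * z)
  *-assoc x y z = ≈-pointwise {(x * y) * z} {x * (y * z)}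
    λ n → ℚ.*-assoc (seq x n) (seq y n) (seq z n)

  *-comm : ∀ x y → x * y ≈ y * x
  *-comm x y = ≈-pointwise {x * y} {y * x} λ n → ℚ.*-comm (seq x n) (seq y n)

  *-identityˡ : ∀ x → 1ℝ * x ≈ x
  *-identityˡ x = ≈-pointwise {1ℝ * x} {x} λ n → ℚ.*-identityˡ (seq x n)

  *-distribˡ-+ : ∀ x y z → x * (y + z) ≈ x * y + x * z
  *-distribˡ-+ x y z = ≈-pointwise {x * (y + z)} {x * y + x * z}
    λ n → ℚ.*-distribˡ-+ (seq x n) (seq y n) (seq z n)

  fromℚ-+ : ∀ p q → fromℚ (p ℚ.+ q) ≈ fromℚ p + fromℚ q
  fromℚ-+ p q = ≈-pointwise {fromℚ (p ℚ.+ q)} {fromℚ p + fromℚ q} λ _ → refl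

  fromℚ-* : ∀ p q → fromℚ (p ℚ.* q) ≈ fromℚ p * fromℚ q
  fromℚ-* p q = ≈-pointwise {fromℚ (p ℚ.* q)} {fromℚ p * fromℚ q} λ _ → refl

  fromℚ-neg : ∀ p → fromℚ (ℚ.- p) ≈ - fromℚ p
  fromℚ-neg p = ≈-pointwise {fromℚ (ℚ.- p)} { - fromℚ p} λ _ → refl

+-*-isCommutativeRing : IsCommutativeRing _≈_ _+_ _*_ -_ 0ℝ 1ℝ
+-*-isCommutativeRing = record
  { isRing = record
    { +-isAbelianGroup = record
      { isGroup = record
        { isMonoid = record
          { isSemigroup = record
            { isMagma = record
              { isEquivalence = ≈-isEquivalence
              ; ∙-cong        = λ {x y u v} → +-cong {x} {y} {u} {v}
              }
            ; assoc = +-assoc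
            }
          ; identity = +-identityˡ , λ x →
              ≈-trans {x + 0ℝ} {0ℝ + x} {x} (+-comm x 0ℝ) (+-identityˡ x)
          }
        ; inverse = -‿inverseˡ , λ x →
            ≈-trans {x - x} { - x + x} {0ℝ} (+-comm x (- x)) (-‿inverseˡ x)
        ; ⁻¹-cong = λ {x y} → -‿cong {x} {y}
        }
      ; comm = +-comm
      }
    ; *-cong     = λ {x y u v} → *-cong {x} {y} {u} {v}
    ; *-assoc    = *-assoc
    ; *-identity = *-identityˡ , λ x →
        ≈-trans {x * 1ℝ} {1ℝ * x} {x} (*-comm x 1ℝ) (*-identityˡ x)
    ; distrib    = *-distribˡ-+ , λ x y z →
        ≈-trans {(y + z) * x} {x * (y + z)} {y * x + z * x} (*-comm (y + z) x)
          (≈-trans {x * (y + z)} {x * y + x * z} {y * x + z * x} (*-distribˡ-+ x y z)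
            (+-cong {x * y} {y * x} {x * z} {z * x} (*-comm x y) (*-comm x z)))
    }
  ; *-comm = *-comm
  }

+-*-commutativeRing : CommutativeRing 0ℓ 0ℓ
+-*-commutativeRing = record { isCommutativeRing = +-*-isCommutativeRing }

-- The strict order on Cauchy reals.

<-irrefl : ∀ {x y} → x ≈ y → ¬ (x < y)
<-irrefl {x} {y} x≈y (ε , 0<ε , x+ε<y) = eventually-constant (eventually-zip
  (λ {n} x+ε<y ∣y-x∣<ε →
    ℚ.<-asym x+ε<y (∣∣<⇒< (seq y n) (seq x n) ∣y-x∣<ε))
  x+ε<y (≈-sym {x} {y} x≈y ε 0<ε))

<-trans : ∀ {x y z} → x < y → y < z → x < z
<-trans {x} {y} {z} (ε , 0<ε , x+ε<y) (δ , 0<δ , y+δ<z) =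
  ε , 0<ε , eventually-zip
    (λ {n} p q → ℚ.<-trans p (ℚ.<-trans
      (subst (ℚ._< seq y n ℚ.+ δ) (ℚ.+-identityʳ (seq y n)) (ℚ.+-monoʳ-< (seq y n) 0<δ)) q))
    x+ε<y y+δ<z

module _ where
  open +-*-Solver

  -- Half of the gap absorbs the error of the approximation, and half remains.
  <-respʳ-≈ : ∀ {x y z} → y ≈ z → x < y → x < z
  <-respʳ-≈ {x} {y} {z} y≈z (ε , 0<ε , x+ε<y) = ½ ℚ.* ε , half-pos 0<ε , eventually-zip
    (λ {n} p q → <-by-difference (ℚ.<-trans p (∣∣<⇒< (seq y n) (seq z n) q))
      (solve 3 (λ x z e → (z :+ con ½ :* e) :- (x :+ e) := z :- (x :+ con ½ :* e)) refl
        (seq x n) (seq z n) ε))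
    x+ε<y (y≈z (½ ℚ.* ε) (half-pos 0<ε))

  <-respˡ-≈ : ∀ {x y z} → y ≈ z → y < x → z < x
  <-respˡ-≈ {x} {y} {z} y≈z (ε , 0<ε , y+ε<x) = ½ ℚ.* ε , half-pos 0<ε , eventually-zip
    (λ {n} p q → <-by-difference (ℚ.+-mono-< p (∣∣<⇒< (seq z n) (seq y n) q))
      (solve 4 (λ x y z e → (x :+ (y :+ con ½ :* e)) :- ((y :+ e) :+ z)
                              := x :- (z :+ con ½ :* e)) refl
        (seq x n) (seq y n) (seq z n) ε))
    y+ε<x (≈-sym {y} {z} y≈z (½ ℚ.* ε) (half-pos 0<ε))

<-isStrictPartialOrder : IsStrictPartialOrder _≈_ _<_
<-isStrictPartialOrder = record
  { isEquivalence = ≈-isEquivalence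
  ; irrefl        = λ {x y} → <-irrefl {x} {y}
  ; trans         = λ {x y z} → <-trans {x} {y} {z}
  ; <-resp-≈      = (λ {x y z} → <-respʳ-≈ {x} {y} {z}) , (λ {x y z} → <-respˡ-≈ {x} {y} {z})
  }

fromℚ-mono-< : ∀ {p q} → p ℚ.< q → fromℚ p < fromℚ q
-- Half the difference, since the gap in `_<_` has to fit strictly.
fromℚ-mono-< {p} {q} p<q = ½ ℚ.* (q ℚ.- p) , half-pos (<⇒0< p<q) , 0 , λ _ _ →
  <-by-difference (half< (<⇒0< p<q))
    (solve 2 (λ p q → (q :- p) :- con ½ :* (q :- p) := q :- (p :+ con ½ :* (q :- p))) refl p q)
  where open +-*-Solver

fromℚ-injective : ∀ {p q} → fromℚ p ≈ fromℚ q → p ≡ q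
fromℚ-injective {p} {q} p≈q with ℚ.<-cmp p q
... | tri< p<q _ _ = contradiction (fromℚ-mono-< p<q) (<-irrefl {fromℚ p} {fromℚ q} p≈q)
... | tri≈ _ p≡q _ = p≡q
... | tri> _ _ q<p = contradiction (fromℚ-mono-< q<p)
  (<-irrefl {fromℚ q} {fromℚ p} (≈-sym {fromℚ p} {fromℚ q} p≈q))

opaque
  unfolding _+_ _*_ -_

  +-monoˡ-< : ∀ z {x y} → x < y → x + z < y + z
  +-monoˡ-< z {x} {y} (ε , 0<ε , x+ε<y) = ε , 0<ε , eventually-map
    (λ {n} p → <-by-difference p
      (solve 4 (λ x y z e → y :- (x :+ e) := (y :+ z) :- ((x :+ z) :+ e)) refl
        (seq x n) (seq y n) (seq z n) ε))
    x+ε<y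
    where open +-*-Solver

  *-pos : ∀ {x y} → 0ℝ < x → 0ℝ < y → 0ℝ < x * y
  *-pos {x} {y} (ε , 0<ε , ε<x) (δ , 0<δ , δ<y) = ε ℚ.* δ , *-pos-ℚ 0<ε 0<δ , eventually-zip
    (λ {n} p q → subst (ℚ._< seq x n ℚ.* seq y n) (sym (ℚ.+-identityˡ (ε ℚ.* δ)))
      (product (subst (ℚ._< seq x n) (ℚ.+-identityˡ ε) p)
               (subst (ℚ._< seq y n) (ℚ.+-identityˡ δ) q)))
    ε<x δ<y
    where
    product : ∀ {a b} → ε ℚ.< a → δ ℚ.< b → ε ℚ.* δ ℚ.< a ℚ.* b
    product {a} {b} ε<a δ<b = ℚ.<-trans
      (ℚ.*-monoʳ-<-pos ε {{ℚ.positive 0<ε}} δ<b)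
      (ℚ.*-monoˡ-<-pos b {{ℚ.positive (ℚ.<-trans 0<δ δ<b)}} ε<a)

-- Beyond some index `N` both sequences stay within `κ` of their terms at `N`, and comparing those
-- two rational terms is decidable.
≮⇒eventually : ∀ {x y} → ¬ (y < x) → ∀ ε → 0ℚ ℚ.< ε →
               Eventually (λ n → seq x n ℚ.< seq y n ℚ.+ ε)
≮⇒eventually {x} {y} y≮x ε 0<ε = bound
  where
  open +-*-Solver

  κ : ℚ
  -- An eighth of `ε`, as the estimate below loses `5κ`.
  κ = ½ ℚ.* (½ ℚ.* (½ ℚ.* ε))

  0<κ : 0ℚ ℚ.< κ
  0<κ = half-pos (half-pos (half-pos 0<ε))

  close : Eventually (λ m → Eventually (λ n →
            ℚ.∣ seq x m ℚ.- seq x n ∣ ℚ.< κ × ℚ.∣ seq y m ℚ.- seq y n ∣ ℚ.< κ))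
  close =
    let M , hx = cauchy x κ 0<κ
        N , hy = cauchy y κ 0<κ
    in M ℕ.⊔ N , λ m p → M ℕ.⊔ N , λ n q →
      hx m n (ℕ.m⊔n≤o⇒m≤o M N p) (ℕ.m⊔n≤o⇒m≤o M N q) ,
      hy m n (ℕ.m⊔n≤o⇒n≤o M N p) (ℕ.m⊔n≤o⇒n≤o M N q)

  N : ℕ
  N = proj₁ close

  near : Eventually (λ n →
           ℚ.∣ seq x N ℚ.- seq x n ∣ ℚ.< κ × ℚ.∣ seq y N ℚ.- seq y n ∣ ℚ.< κ)
  near = proj₂ close N ℕ.≤-refl

  bound : Eventually (λ n → seq x n ℚ.< seq y n ℚ.+ ε)
  bound with seq y N ℚ.+ (κ ℚ.+ κ ℚ.+ κ) ℚ.<? seq x N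
  -- Two errors of size `κ` still leave a gap of `κ`, so `y < x`.
  ... | yes y+3κ<x = contradiction
    (κ , 0<κ , eventually-map
      (λ {n} (p , q) → <-by-difference
        (ℚ.+-mono-< (ℚ.+-mono-< (∣∣<⇒< (seq x N) (seq x n) p)
          (∣∣<⇒< (seq y n) (seq y N)
            (subst (ℚ._< κ) (∣-∣-comm (seq y N) (seq y n)) q))) y+3κ<x)
        (solve 5 (λ X Y x y k →
          (((x :+ k) :+ (Y :+ k)) :+ X) :- ((X :+ y) :+ (Y :+ (k :+ k :+ k)))
            := x :- (y :+ k)) refl
          (seq x N) (seq y N) (seq x n) (seq y n) κ))
      near)
    y≮x
  -- Two errors of size `κ` on top of `3κ` give `5κ`.
  ... | no y+3κ≮x = eventually-map
    (λ {n} (p , q) → ℚ.<-trans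
      (<-by-difference
        (ℚ.+-mono-<-≤ (ℚ.+-mono-< (∣∣<⇒< (seq y N) (seq y n) q)
          (∣∣<⇒< (seq x n) (seq x N)
            (subst (ℚ._< κ) (∣-∣-comm (seq x N) (seq x n)) p))) (ℚ.≮⇒≥ y+3κ≮x))
        (solve 5 (λ X Y x y k →
          (((y :+ k) :+ (X :+ k)) :+ (Y :+ (k :+ k :+ k))) :- ((Y :+ x) :+ X)
            := (y :+ (k :+ k :+ k :+ k :+ k)) :- x) refl
          (seq x N) (seq y N) (seq x n) (seq y n) κ))
      (ℚ.+-monoʳ-< (seq y n) 5κ<ε))
    near
    where
    5κ<ε : κ ℚ.+ κ ℚ.+ κ ℚ.+ κ ℚ.+ κ ℚ.< ε
    5κ<ε = <-by-difference (ℚ.+-mono-< 0<κ (ℚ.+-mono-< 0<κ 0<κ))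
      (solve 1 (λ e → let k = con ½ :* (con ½ :* (con ½ :* e)) in
        (k :+ (k :+ k)) :- (con 0ℚ :+ (con 0ℚ :+ con 0ℚ)) := e :- (k :+ k :+ k :+ k :+ k))
        refl ε)

<-connected : ∀ {x y} → ¬ (x < y) → ¬ (y < x) → x ≈ y
<-connected {x} {y} x≮y y≮x ε 0<ε = eventually-zip <⇒∣∣<
  (≮⇒eventually {x} {y} y≮x ε 0<ε) (≮⇒eventually {y} {x} x≮y ε 0<ε)

-- Raising the terms of x to at least ε changes only finitely many of them
-- and makes every term invertible.
inverse : ∀ {x} → 0ℝ < x → ∃[ y ] (x * y ≈ 1ℝ)
inverse {x} (ε , 0<ε , ε<x) = x⁻¹ , x*x⁻¹≈1
  where
  s : ℕ → ℚ
  s n = seq x n ℚ.⊔ ε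

  0<s : ∀ n → 0ℚ ℚ.< s n
  0<s n = ℚ.<-≤-trans 0<ε (ℚ.p≤q⊔p (seq x n) ε)

  s≢0 : ∀ n → ℚ.NonZero (s n)
  s≢0 n = ℚ.pos⇒nonZero (s n) {{ℚ.positive (0<s n)}}

  s⁻¹ : ℕ → ℚ
  s⁻¹ n = (ℚ.1/ s n) {{s≢0 n}}

  s*s⁻¹ : ∀ n → s n ℚ.* s⁻¹ n ≡ 1ℚ
  s*s⁻¹ n = ℚ.*-inverseʳ (s n) {{s≢0 n}}

  eventually-s : Eventually (λ n → s n ≡ seq x n)
  eventually-s = eventually-map
    (λ {n} p → ℚ.p≥q⇒p⊔q≡p (ℚ.<⇒≤ (subst (ℚ._< seq x n) (ℚ.+-identityˡ ε) p))) ε<x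

  cancel : ∀ n q → s n ℚ.* (s⁻¹ n ℚ.* q) ≡ q
  cancel n q = trans (sym (ℚ.*-assoc (s n) (s⁻¹ n) q))
    (trans (cong (ℚ._* q) (s*s⁻¹ n)) (ℚ.*-identityˡ q))

  cauchy⁻¹ : IsCauchy s⁻¹
  cauchy⁻¹ η 0<η =
    -- Inverses of numbers that are at least `ε` differ by at most `1/ε²` times the difference of
    -- the numbers, hence this tolerance.
    let N , h = cauchy x (ε ℚ.* ε ℚ.* η) (*-pos-ℚ (*-pos-ℚ 0<ε 0<ε) 0<η)
        K , e = eventually-s
    in N ℕ.⊔ K , λ m n p q → <⇒∣∣<
      (close m n (e m (ℕ.m⊔n≤o⇒n≤o N K p)) (e n (ℕ.m⊔n≤o⇒n≤o N K q))
        (h n m (ℕ.m⊔n≤o⇒m≤o N K q) (ℕ.m⊔n≤o⇒m≤o N K p)))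
      (close n m (e n (ℕ.m⊔n≤o⇒n≤o N K q)) (e m (ℕ.m⊔n≤o⇒n≤o N K p))
        (h m n (ℕ.m⊔n≤o⇒m≤o N K p) (ℕ.m⊔n≤o⇒m≤o N K q)))
    where
    open +-*-Solver

    close : ∀ m n → s m ≡ seq x m → s n ≡ seq x n →
            ℚ.∣ seq x n ℚ.- seq x m ∣ ℚ.< ε ℚ.* ε ℚ.* η → s⁻¹ m ℚ.< s⁻¹ n ℚ.+ η
    close m n em en h = cancel-< (begin-strict
      s m ℚ.* s n ℚ.* s⁻¹ m              ≡⟨ solve 3 (λ a b c → a :* b :* c := a :* (c :* b))
                                              refl (s m) (s n) (s⁻¹ m) ⟩
      s m ℚ.* (s⁻¹ m ℚ.* s n)            ≡⟨ cancel m (s n) ⟩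
      s n                                <⟨ ∣∣<⇒< (s n) (s m)
                                              (subst₂ (λ a b → ℚ.∣ a ℚ.- b ∣ ℚ.< ε ℚ.* ε ℚ.* η)
                                                (sym en) (sym em) h) ⟩
      s m ℚ.+ ε ℚ.* ε ℚ.* η              ≤⟨ ℚ.+-monoʳ-≤ (s m) (ℚ.*-monoʳ-≤-nonNeg η
                                              {{ℚ.nonNegative (ℚ.<⇒≤ 0<η)}} ε²≤) ⟩
      s m ℚ.+ s m ℚ.* s n ℚ.* η          ≡⟨ cong (ℚ._+ s m ℚ.* s n ℚ.* η)
                                              (sym (cancel n (s m))) ⟩
      s n ℚ.* (s⁻¹ n ℚ.* s m) ℚ.+ s m ℚ.* s n ℚ.* η
        ≡⟨ solve 4 (λ a b c d → b :* (c :* a) :+ a :* b :* d := a :* b :* (c :+ d))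
             refl (s m) (s n) (s⁻¹ n) η ⟩
      s m ℚ.* s n ℚ.* (s⁻¹ n ℚ.+ η)      ∎)
      where
      open ℚ.≤-Reasoning
      0<sm*sn : 0ℚ ℚ.< s m ℚ.* s n
      0<sm*sn = *-pos-ℚ (0<s m) (0<s n)
      cancel-< : ∀ {p q} → s m ℚ.* s n ℚ.* p ℚ.< s m ℚ.* s n ℚ.* q → p ℚ.< q
      cancel-< = ℚ.*-cancelˡ-<-nonNeg (s m ℚ.* s n) {{ℚ.nonNegative (ℚ.<⇒≤ 0<sm*sn)}}
      ε²≤ : ε ℚ.* ε ℚ.≤ s m ℚ.* s n
      ε²≤ = ℚ.≤-trans
        (ℚ.*-monoʳ-≤-nonNeg ε {{ℚ.nonNegative (ℚ.<⇒≤ 0<ε)}} (ℚ.p≤q⊔p (seq x m) ε))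
        (ℚ.*-monoˡ-≤-nonNeg (s m) {{ℚ.nonNegative (ℚ.<⇒≤ (0<s m))}} (ℚ.p≤q⊔p (seq x n) ε))

  x⁻¹ : ℝ
  x⁻¹ = mkℝ s⁻¹ cauchy⁻¹

  opaque
    unfolding _*_

    x*x⁻¹≈1 : x * x⁻¹ ≈ 1ℝ
    x*x⁻¹≈1 η 0<η = eventually-map
      (λ {n} eq → subst (ℚ._< η)
        (cong (λ q → ℚ.∣ q ℚ.- 1ℚ ∣) (trans (sym (s*s⁻¹ n)) (cong (ℚ._* s⁻¹ n) eq))) 0<η)
      eventually-s

ℝ-orderedField : OrderedField
ℝ-orderedField = record
  { commutativeRing      = +-*-commutativeRing
  ; _<_                  = _<_
  ; isStrictPartialOrder = <-isStrictPartialOrder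
  ; connected            = λ {x y} → <-connected {x} {y}
  ; +-monoˡ-<            = λ z {x y} → +-monoˡ-< z {x} {y}
  ; *-pos                = λ {x y} → *-pos {x} {y}
  ; inverse              = λ {x} → inverse {x}
  ; rationals            = record
    { ⟦_⟧    = fromℚ
    ; +-homo = fromℚ-+
    ; *-homo = fromℚ-*
    ; -‿homo = fromℚ-neg
    ; 0-homo = ≈-refl {0ℝ}
    ; 1-homo = ≈-refl {1ℝ}
    }
  }

-- Signs of reals and orientations of rational points.

open Geometry ℝ-orderedField
  using (IsConvexSet; collinear⇒common; crossing-family-impossible)

isConvexSet : ∀ {K} → CompactConvex K → IsConvexSet K
isConvexSet K-compactConvex = record
  { respects = λ {p q} → respects {p} {q}
  ; convex   = λ {p q} → convex {p} {q}
  }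
  where open CompactConvex K-compactConvex

-- `SameOrientations` supplies its sign existentially; uniqueness identifies it with the sign
-- computed from the coordinates.
HasSign-unique : ∀ {x s t} → HasSign x s → HasSign x t → s ≡ t
HasSign-unique (positive _) (positive _) = refl
HasSign-unique (zero _)     (zero _)     = refl
HasSign-unique (negative _) (negative _) = refl
HasSign-unique {x} (positive 0<x) (zero x≈0) =
  contradiction 0<x (<-irrefl {0ℝ} {x} (≈-sym {x} {0ℝ} x≈0))
HasSign-unique {x} (zero x≈0) (positive 0<x) =
  contradiction 0<x (<-irrefl {0ℝ} {x} (≈-sym {x} {0ℝ} x≈0))
HasSign-unique {x} (negative x<0) (zero x≈0) = contradiction x<0 (<-irrefl {x} {0ℝ} x≈0)
HasSign-unique {x} (zero x≈0) (negative x<0) = contradiction x<0 (<-irrefl {x} {0ℝ} x≈0)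
HasSign-unique {x} (positive 0<x) (negative x<0) =
  contradiction (<-trans {x} {0ℝ} {x} x<0 0<x) (<-irrefl {x} {x} (≈-refl {x}))
HasSign-unique {x} (negative x<0) (positive 0<x) =
  contradiction (<-trans {x} {0ℝ} {x} x<0 0<x) (<-irrefl {x} {x} (≈-refl {x}))

-- Rational signs are decidable, so the orientations of the five points evaluate to literals and
-- conditions on them hold by `refl` or `λ ()`.
signℚ : ℚ → ℤ
signℚ q with ℚ.<-cmp q 0ℚ
... | tri< _ _ _ = -1ℤ
... | tri≈ _ _ _ = 0ℤ
... | tri> _ _ _ = 1ℤ

HasSign-fromℚ : ∀ q {x} → x ≈ fromℚ q → HasSign x (signℚ q)
HasSign-fromℚ q {x} x≈q with ℚ.<-cmp q 0ℚ
... | tri< q<0 _ _ = negative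
  (<-respˡ-≈ {0ℝ} {fromℚ q} {x} (≈-sym {x} {fromℚ q} x≈q) (fromℚ-mono-< q<0))
... | tri≈ _ q≡0 _ = zero (subst (λ r → x ≈ fromℚ r) q≡0 x≈q)
... | tri> _ _ 0<q = positive
  (<-respʳ-≈ {0ℝ} {fromℚ q} {x} (≈-sym {x} {fromℚ q} x≈q) (fromℚ-mono-< 0<q))

ℚPoint : Set
ℚPoint = ℚ × ℚ

toPoint : ℚPoint → Point
toPoint (x , y) = fromℚ x , fromℚ y

areaℚ : ℚPoint → ℚPoint → ℚPoint → ℚ
areaℚ (px , py) (qx , qy) (rx , ry) =
  (qx ℚ.- px) ℚ.* (ry ℚ.- py) ℚ.- (qy ℚ.- py) ℚ.* (rx ℚ.- px)

opaque
  unfolding _+_ _*_ -_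

  area₂-toPoint : ∀ p q r → area₂ (toPoint p) (toPoint q) (toPoint r) ≈ fromℚ (areaℚ p q r)
  area₂-toPoint p q r =
    ≈-pointwise {area₂ (toPoint p) (toPoint q) (toPoint r)} {fromℚ (areaℚ p q r)} λ _ → refl

-- The vertices of a convex quadrilateral, opposite ones adjacent in the list,
-- and the intersection of its diagonals.
points : Fin 5 → ℚPoint
points = lookup ((1ℚ , 0ℚ) ∷ (ℚ.- 1ℚ , 0ℚ) ∷ (0ℚ , 1ℚ) ∷ (0ℚ , ℚ.- 1ℚ) ∷ (0ℚ , 0ℚ) ∷ [])

points-distinct : AllDistinct (λ i → toPoint (points i))
points-distinct i j i≢j (x≈x′ , y≈y′) =
  i≢j (injective i j (fromℚ-injective x≈x′ , fromℚ-injective y≈y′))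
  where
  injective : ∀ i j → proj₁ (points i) ≡ proj₁ (points j) × proj₂ (points i) ≡ proj₂ (points j) →
              i ≡ j
  -- A finite check over all pairs of indices, done by evaluation.
  injective = from-yes (all? λ i → all? λ j →
    (proj₁ (points i) ℚ.≟ proj₁ (points j) ×-dec proj₂ (points i) ℚ.≟ proj₂ (points j)) →-dec (i ≟ j))

-- Unrealizability of the five points.

module _ (K : Fin 5 → Pred Point 0ℓ) (compactConvex : ∀ i → CompactConvex (K i))
         (pairwise : PairwiseIntersecting K)
         (same : SameOrientations K (λ i → toPoint (points i))) where

  o : Fin 5 → Fin 5 → Fin 5 → ℤ
  o i j k = signℚ (areaℚ (points i) (points j) (points k))

  oriented : ∀ i j k → i ≢ j → j ≢ k → i ≢ k → SetOrientation (K i) (K j) (K k) (o i j k)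
  oriented i j k i≢j j≢k i≢k =
    let s , K-oriented , p-oriented = same i j k i≢j j≢k i≢k
    in subst (SetOrientation (K i) (K j) (K k))
         (HasSign-unique p-oriented
           (HasSign-fromℚ _ (area₂-toPoint (points i) (points j) (points k))))
         K-oriented

  convexSet : ∀ i → IsConvexSet (K i)
  convexSet i = isConvexSet (compactConvex i)

  nonzero⇒empty : ∀ {A B C s} → SetOrientation A B C s → s ≢ 0ℤ → Empty (A ∩ B ∩ C)
  nonzero⇒empty orientation s≢0 x x∈A∩B∩C =
    s≢0 (SetOrientation.common orientation (x , x∈A∩B∩C))

  -- With an empty triple intersection, the orientation zero would make witnesses of the pairwise
  -- intersections collinear, which forces a common point.
  zero⇒common : ∀ i j k → i ≢ j → j ≢ k → i ≢ k → o i j k ≡ 0ℤ →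
                ¬ Empty (K i ∩ K j ∩ K k)
  zero⇒common i j k i≢j j≢k i≢k o≡0 empty =
    let x , x∈ = pairwise j k j≢k
        y , y∈ = pairwise i k i≢k
        z , z∈ = pairwise i j i≢j
    in collinear⇒common (convexSet i) (convexSet j) (convexSet k) x∈ y∈ z∈
         (isZero (subst (HasSign (area₂ x y z)) o≡0
           (SetOrientation.disjoint (oriented i j k i≢j j≢k i≢k) empty x∈ y∈ z∈)))
         empty
    where
    isZero : ∀ {x} → HasSign x 0ℤ → x ≈ 0ℝ
    isZero (zero x≈0) = x≈0

  unrealizable : ⊥
  unrealizable =
    -- The two diagonals give the collinear triples. As the goal is `⊥`, each `¬ Empty` yields an
    -- actual point.
    zero⇒common 0F 1F 4F (λ ()) (λ ()) (λ ()) refl λ x x∈ →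
    zero⇒common 2F 3F 4F (λ ()) (λ ()) (λ ()) refl λ y y∈ →
    -- The indices are ordered so that `disjoint` takes `x` and `y` as its first two points in all
    -- four triples, hence gives heights over the same directed line.
    let o₂₀₄ = oriented 2F 0F 4F (λ ()) (λ ()) (λ ())
        o₃₀₄ = oriented 3F 0F 4F (λ ()) (λ ()) (λ ())
        o₂₁₄ = oriented 2F 1F 4F (λ ()) (λ ()) (λ ())
        o₃₁₄ = oriented 3F 1F 4F (λ ()) (λ ()) (λ ())
        K₂₀₄ = nonzero⇒empty o₂₀₄ (λ ())
        K₃₀₄ = nonzero⇒empty o₃₀₄ (λ ())
        K₂₁₄ = nonzero⇒empty o₂₁₄ (λ ())
        K₃₁₄ = nonzero⇒empty o₃₁₄ (λ ())
        _ , p∈ = pairwise 2F 0F (λ ())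
        _ , q∈ = pairwise 3F 1F (λ ())
        _ , r∈ = pairwise 3F 0F (λ ())
        _ , s∈ = pairwise 2F 1F (λ ())
        x∈K₀ , x∈K₁ , x∈K₄ = x∈
        y∈K₂ , y∈K₃ , y∈K₄ = y∈
    in crossing-family-impossible
         (convexSet 0F) (convexSet 1F) (convexSet 2F) (convexSet 3F) (convexSet 4F)
         K₂₀₄ K₃₀₄ K₂₁₄ K₃₁₄ x∈ y∈ p∈ q∈ r∈ s∈
         (isNegative (SetOrientation.disjoint o₂₀₄ K₂₀₄ (x∈K₀ , x∈K₄) (y∈K₂ , y∈K₄) p∈))
         (isNegative (SetOrientation.disjoint o₃₁₄ K₃₁₄ (x∈K₁ , x∈K₄) (y∈K₃ , y∈K₄) q∈))
         (isPositive (SetOrientation.disjoint o₃₀₄ K₃₀₄ (x∈K₀ , x∈K₄) (y∈K₃ , y∈K₄) r∈))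
         (isPositive (SetOrientation.disjoint o₂₁₄ K₂₁₄ (x∈K₁ , x∈K₄) (y∈K₂ , y∈K₄) s∈))
    where
    isNegative : ∀ {x} → HasSign x -1ℤ → x < 0ℝ
    isNegative (negative x<0) = x<0

    isPositive : ∀ {x} → HasSign x 1ℤ → 0ℝ < x
    isPositive (positive 0<x) = 0<x

theorem2 : Σ[ p ∈ (Fin 5 → Point) ]
    AllDistinct p ×
    ¬ (Σ[ K ∈ (Fin 5 → Pred Point 0ℓ) ]
    (∀ i → CompactConvex (K i)) ×
    PairwiseIntersecting K ×
    SameOrientations K p)
theorem2 = (λ i → toPoint (points i)) , points-distinct ,
  λ (K , compactConvex , pairwise , same) → unrealizable K compactConvex pairwise same
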